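{- Let $k\geq 2$ be even and let $G$ and $H$ be two $k$-uniform odd-bipartite hypergraphs. Then their Cartesian product $G\Box H$ is also odd-bipartite.
   Context: A $k$-uniform hypergraph $F=(V,E)$ has a finite nonempty vertex set $V$ and a set $E$ of edges, each edge being a $k$-element subset of $V$. It is odd-bipartite if $k$ is even and there is a proper subset $V_1\subsetneq V$ such that every edge of $F$ contains an odd number of vertices of $V_1$. The Cartesian product $G\Box H$ of $k$-uniform hypergraphs has vertex set $V(G)\times V(H)$, and $\{(i_1,j_1),\dots,(i_k,j_k)\}$ is an edge if and only if either $i_1=\cdots=i_k$ and $\{j_1,\dots,j_k\}\in E(H)$, or $j_1=\cdots=j_k$ and $\{i_1,\dots,i_k\}\in E(G)$. It is again $k$-uniform. -}

module Defs where

open import Data.Bool.Base using (true; false)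
open import Data.Fin.Base using (Fin; zero; suc; combine)
open import Data.Fin.Properties using (combine-injectiveˡ; combine-injectiveʳ)
open import Data.Fin.Subset
  using (Subset; ⊤; ⊥; ⁅_⁆; _∪_; _∩_; ⋃; _∈_; _∉_; _⊂_; ∣_∣)
open import Data.Fin.Subset.Properties
  using (∉⊥; x∈⁅x⁆; x∈⁅y⁆⇒x≡y; x∈p∪q⁺; x∈p∪q⁻; ∪-identityˡ; _∈?_; ∣⊥∣≡0)
open import Data.List.Base using (tabulate)
open import Data.Nat.Base using (ℕ; zero; suc; _*_; _≤_; s≤s; NonZero)
open import Data.Nat.Divisibility using (_∣_; _∤_)
open import Data.Nat.Properties
  using (m*n≢0; suc-injective; ≤-reflexive; m≤n⇒m≤1+n; 1+n≰n)
open import Data.Product.Base using (∃; ∃₂; _×_; _,_)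
open import Data.Sum.Base using (_⊎_; inj₁; inj₂)
open import Data.Vec.Base using (_∷_)
import Data.Vec.Base as Vec using (here; there)
open import Function.Base using (_∘_)
open import Level using (0ℓ)
open import Relation.Binary.PropositionalEquality
  using (_≡_; refl; sym; trans; cong; subst)
open import Relation.Nullary.Decidable.Core using (yes; no)
open import Relation.Nullary.Negation.Core using (contradiction)
open import Relation.Unary using (Pred)

private
  variable
    k m n : ℕ

-- The set {f₁,…,f_k}; it has fewer than k elements when f has repetitions.
image : (Fin k → Fin n) → Subset n
image f = ⋃ (tabulate (λ a → ⁅ f a ⁆))

-- A finite nonempty vertex set is represented by Fin order with order nonzero.
-- Subset equality is propositional, so E is a set of genuine (unordered) subsets.
record Hypergraph (k : ℕ) : Set₁ where
  field
    order         : ℕ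
    order-nonZero : NonZero order
    E             : Pred (Subset order) 0ℓ
    uniform       : ∀ e → E e → ∣ e ∣ ≡ k

open Hypergraph public

-- V₁ ⊂ ⊤ is strict inclusion: some vertex lies outside V₁ (V₁ may be empty).
OddBipartite : Hypergraph k → Set
OddBipartite {k} F =
  2 ∣ k × ∃ λ (V₁ : Subset (order F)) →
    V₁ ⊂ ⊤ × (∀ e → E F e → 2 ∤ ∣ e ∩ V₁ ∣)

-- Vertices of the product are pairs (i , j), encoded in Fin (m * n) by the
-- bijection combine.
□-Edge : (G H : Hypergraph k) → Pred (Subset (order G * order H)) 0ℓ
□-Edge {k} G H e =
  ∃₂ λ (i : Fin k → Fin (order G)) (j : Fin k → Fin (order H)) →
    e ≡ image (λ a → combine (i a) (j a)) ×
    ( ((∀ a b → i a ≡ i b) × E H (image j))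
    ⊎ ((∀ a b → j a ≡ j b) × E G (image i)) )

∣⁅x⁆∪p∣-∉ : (x : Fin n) (p : Subset n) → x ∉ p → ∣ ⁅ x ⁆ ∪ p ∣ ≡ suc ∣ p ∣
∣⁅x⁆∪p∣-∉ zero    (true  ∷ p) x∉p = contradiction Vec.here x∉p
∣⁅x⁆∪p∣-∉ zero    (false ∷ p) x∉p = cong (suc ∘ ∣_∣) (∪-identityˡ p)
∣⁅x⁆∪p∣-∉ (suc x) (true  ∷ p) x∉p = cong suc (∣⁅x⁆∪p∣-∉ x p (x∉p ∘ Vec.there))
∣⁅x⁆∪p∣-∉ (suc x) (false ∷ p) x∉p = ∣⁅x⁆∪p∣-∉ x p (x∉p ∘ Vec.there)

∣⁅x⁆∪p∣-∈ : (x : Fin n) (p : Subset n) → x ∈ p → ∣ ⁅ x ⁆ ∪ p ∣ ≡ ∣ p ∣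
∣⁅x⁆∪p∣-∈ zero    (true  ∷ p) Vec.here        = cong (suc ∘ ∣_∣) (∪-identityˡ p)
∣⁅x⁆∪p∣-∈ (suc x) (true  ∷ p) (Vec.there x∈p) = cong suc (∣⁅x⁆∪p∣-∈ x p x∈p)
∣⁅x⁆∪p∣-∈ (suc x) (false ∷ p) (Vec.there x∈p) = ∣⁅x⁆∪p∣-∈ x p x∈p

∈-image⁺ : (f : Fin k → Fin n) (a : Fin k) → f a ∈ image f
∈-image⁺ f zero    = x∈p∪q⁺ (inj₁ (x∈⁅x⁆ (f zero)))
∈-image⁺ f (suc a) = x∈p∪q⁺ (inj₂ (∈-image⁺ (f ∘ suc) a))

∈-image⁻ : (f : Fin k → Fin n) {x : Fin n} → x ∈ image f → ∃ λ a → x ≡ f a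
∈-image⁻ {zero}  f x∈ = contradiction x∈ ∉⊥
∈-image⁻ {suc k} f x∈ with x∈p∪q⁻ ⁅ f zero ⁆ _ x∈
... | inj₁ x∈⁅⁆ = zero , x∈⁅y⁆⇒x≡y (f zero) x∈⁅⁆
... | inj₂ x∈′  with a , eq ← ∈-image⁻ (f ∘ suc) x∈′ = suc a , eq

∣image∣≤k : (f : Fin k → Fin n) → ∣ image f ∣ ≤ k
∣image∣≤k {zero} {n} f = ≤-reflexive (∣⊥∣≡0 n)
∣image∣≤k {suc k} f with f zero ∈? image (f ∘ suc)
... | yes f₀∈ rewrite ∣⁅x⁆∪p∣-∈ _ _ f₀∈ = m≤n⇒m≤1+n (∣image∣≤k (f ∘ suc))
... | no  f₀∉ rewrite ∣⁅x⁆∪p∣-∉ _ _ f₀∉ = s≤s (∣image∣≤k (f ∘ suc))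

∣image∣-lift : (f : Fin k → Fin m) (g : Fin k → Fin n) →
               (∀ a b → g a ≡ g b → f a ≡ f b) →
               ∣ image f ∣ ≡ k → ∣ image g ∣ ≡ k
∣image∣-lift {zero} {n = n} f g g⇒f _ = ∣⊥∣≡0 n
∣image∣-lift {suc k} f g g⇒f eq with f zero ∈? image (f ∘ suc)
... | yes f₀∈ = contradiction
  (subst (_≤ k) (trans (sym (∣⁅x⁆∪p∣-∈ _ _ f₀∈)) eq) (∣image∣≤k (f ∘ suc)))
  1+n≰n
... | no f₀∉ = trans (∣⁅x⁆∪p∣-∉ _ _ g₀∉) (cong suc
    (∣image∣-lift (f ∘ suc) (g ∘ suc) (λ a b → g⇒f (suc a) (suc b))
      (suc-injective (trans (sym (∣⁅x⁆∪p∣-∉ _ _ f₀∉)) eq))))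
  where
  g₀∉ : g zero ∉ image (g ∘ suc)
  g₀∉ g₀∈ with a , g₀≡ ← ∈-image⁻ (g ∘ suc) g₀∈ =
    f₀∉ (subst (_∈ image (f ∘ suc)) (sym (g⇒f zero (suc a) g₀≡))
          (∈-image⁺ (f ∘ suc) a))

□-uniform : (G H : Hypergraph k) → ∀ e → □-Edge G H e → ∣ e ∣ ≡ k
□-uniform G H _ (i , j , refl , inj₁ (_ , j∈E)) =
  ∣image∣-lift j _ (λ a b → combine-injectiveʳ (i a) (j a) (i b) (j b))
    (uniform H _ j∈E)
□-uniform G H _ (i , j , refl , inj₂ (_ , i∈E)) =
  ∣image∣-lift i _ (λ a b → combine-injectiveˡ (i a) (j a) (i b) (j b))
    (uniform G _ i∈E)

infixr 7 _□_

_□_ : Hypergraph k → Hypergraph k → Hypergraph k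
G □ H = record
  { order         = order G * order H
  ; order-nonZero = m*n≢0 (order G) (order H)
                      {{order-nonZero G}} {{order-nonZero H}}
  ; E             = □-Edge G H
  ; uniform       = □-uniform G H
  }

{-# OPTIONS --safe #-}

-- For proper sets V₁ ⊂ V(G) and V₂ ⊂ V(H) meeting every edge oddly, take W to be
-- the pairs (i , j) for which exactly one of i ∈ V₁, j ∈ V₂ holds.  An edge
-- {i} × e of the product meets W in ∣ e ∩ V₂ ∣ vertices if i ∉ V₁ and in
-- k − ∣ e ∩ V₂ ∣ vertices if i ∈ V₁; both are odd as k is even.  Edges e × {j}
-- are symmetric, and W misses (i , j) whenever i ∉ V₁ and j ∉ V₂.
module Submission where

open import Defs
open import Data.Bool.Base using (true; false; _∧_; _xor_)
open import Data.Bool.Properties using (¬-not; xor-comm)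
open import Data.Fin.Base using (Fin; zero; suc; combine; remQuot)
open import Data.Fin.Properties using (remQuot-combine)
open import Data.Fin.Subset using (Subset; ⊤; ⊥; ⁅_⁆; _∪_; _∩_; _∉_; _⊂_; ∣_∣)
open import Data.Fin.Subset.Properties
  using (∪-identityˡ; _∈?_; ∣∁p∣≡n∸∣p∣; ∣p∣≤n; ∈⊤; ⊆⊤; ∩-zeroˡ; ∣⊥∣≡0)
open import Data.Nat.Base using (ℕ; zero; suc; _*_; _≤_)
open import Data.Nat.Divisibility using (_∣_; _∤_; ∣m+n∣m⇒∣n)
open import Data.Nat.Properties using (suc-injective; 1+n≰n; m∸n+n≡m)
open import Data.Product.Base using (_,_; uncurry)
open import Data.Sum.Base using (inj₁; inj₂)
open import Data.Vec.Base as Vec using (_∷_; lookup; map; tabulate)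
open import Data.Vec.Properties
  using (map-id; tabulate-∘; tabulate-cong; lookup∘tabulate; []=⇒lookup; lookup⇒[]=)
open import Function.Base using (_∘_)
open import Relation.Binary.PropositionalEquality
  using (_≡_; refl; sym; trans; cong; cong₂; subst; module ≡-Reasoning)
open import Relation.Nullary.Decidable.Core using (yes; no)
open import Relation.Nullary.Negation.Core using (contradiction)

private
  variable
    k m n : ℕ

∣∷∣-cong : ∀ b (p : Subset m) (q : Subset n) → ∣ p ∣ ≡ ∣ q ∣ → ∣ b ∷ p ∣ ≡ ∣ b ∷ q ∣
∣∷∣-cong true  p q eq = cong suc eq
∣∷∣-cong false p q eq = eq

∣∷∷∣-swap : ∀ b c (p : Subset n) → ∣ b ∷ c ∷ p ∣ ≡ ∣ c ∷ b ∷ p ∣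
∣∷∷∣-swap true  true  p = refl
∣∷∷∣-swap true  false p = refl
∣∷∷∣-swap false true  p = refl
∣∷∷∣-swap false false p = refl

-- The contribution of `x` is recorded as an extra leading bit, so that no case split on
-- `lookup V x` is needed and no addition appears.
∣⁅x⁆∪p∩V∣-∉ : (x : Fin n) (p V : Subset n) → x ∉ p →
              ∣ (⁅ x ⁆ ∪ p) ∩ V ∣ ≡ ∣ lookup V x ∷ p ∩ V ∣
∣⁅x⁆∪p∩V∣-∉ zero    (true  ∷ p) (v ∷ V) x∉p = contradiction Vec.here x∉p
∣⁅x⁆∪p∩V∣-∉ zero    (false ∷ p) (v ∷ V) x∉p =
  ∣∷∣-cong v ((⊥ ∪ p) ∩ V) (false ∷ p ∩ V) (cong (λ q → ∣ q ∩ V ∣) (∪-identityˡ p))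
∣⁅x⁆∪p∩V∣-∉ (suc x) (s ∷ p) (v ∷ V) x∉p = trans
  (∣∷∣-cong (s ∧ v) ((⁅ x ⁆ ∪ p) ∩ V) (lookup V x ∷ p ∩ V)
    (∣⁅x⁆∪p∩V∣-∉ x p V (x∉p ∘ Vec.there)))
  -- The recursive call leaves the bit for `x` behind the head bit `s ∧ v`; exchanging the two does
  -- not change the count.
  (∣∷∷∣-swap (s ∧ v) (lookup V x) (p ∩ V))

-- An image of full size `k` forces `f` to be injective, so each vertex of the edge is hit by one
-- position. Counting then moves from vertices to the `k` positions.
∣image∩V∣ : (f : Fin k → Fin n) (V : Subset n) → ∣ image f ∣ ≡ k →
            ∣ image f ∩ V ∣ ≡ ∣ tabulate (lookup V ∘ f) ∣
∣image∩V∣ {zero} {n} f V _ = trans (cong ∣_∣ (∩-zeroˡ V)) (∣⊥∣≡0 n)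
∣image∩V∣ {suc k} f V eq with f zero ∈? image (f ∘ suc)
-- A repeated value would leave at most `k` elements in an image of size `suc k`.
... | yes f₀∈ = contradiction
  (subst (_≤ k) (trans (sym (∣⁅x⁆∪p∣-∈ _ _ f₀∈)) eq) (∣image∣≤k (f ∘ suc)))
  1+n≰n
... | no f₀∉ = trans (∣⁅x⁆∪p∩V∣-∉ (f zero) (image (f ∘ suc)) V f₀∉)
  (∣∷∣-cong (lookup V (f zero)) (image (f ∘ suc) ∩ V) (tabulate (lookup V ∘ f ∘ suc))
    (∣image∩V∣ (f ∘ suc) V (suc-injective (trans (sym (∣⁅x⁆∪p∣-∉ _ _ f₀∉)) eq))))

-- The map is the identity for `false` and the complement for `true`; the sizes of `p` and its
-- complement add up to the even number `k`, so they have the same parity.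
∤∣map-xor∣ : ∀ b (p : Subset k) → 2 ∣ k → 2 ∤ ∣ p ∣ → 2 ∤ ∣ map (b xor_) p ∣
∤∣map-xor∣ false p 2∣k odd = odd ∘ subst (λ q → 2 ∣ ∣ q ∣) (map-id p)
∤∣map-xor∣ true  p 2∣k odd even = odd (∣m+n∣m⇒∣n
  (subst (2 ∣_) (sym (m∸n+n≡m (∣p∣≤n p))) 2∣k)
  (subst (2 ∣_) (∣∁p∣≡n∸∣p∣ p) even))

-- Meant for `f` listing a product edge and `g` its varying coordinate, with `b` the membership bit
-- of the fixed coordinate. Read along the `k` positions, the two intersections differ by a uniform
-- `b xor_`.
odd-transfer : (f : Fin k → Fin m) (g : Fin k → Fin n) (U : Subset m) (V : Subset n) →
               ∀ b → (∀ a → lookup U (f a) ≡ b xor lookup V (g a)) →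
               ∣ image f ∣ ≡ k → ∣ image g ∣ ≡ k → 2 ∣ k →
               2 ∤ ∣ image g ∩ V ∣ → 2 ∤ ∣ image f ∩ U ∣
odd-transfer f g U V b U≗V ∣f∣ ∣g∣ 2∣k odd =
  ∤∣map-xor∣ b (tabulate (lookup V ∘ g)) 2∣k
    (odd ∘ subst (2 ∣_) (sym (∣image∩V∣ g V ∣g∣)))
  ∘ subst (2 ∣_) (begin
      ∣ image f ∩ U ∣                           ≡⟨ ∣image∩V∣ f U ∣f∣ ⟩
      ∣ tabulate (lookup U ∘ f) ∣               ≡⟨ cong ∣_∣ (tabulate-cong U≗V) ⟩
      ∣ tabulate ((b xor_) ∘ lookup V ∘ g) ∣    ≡⟨ cong ∣_∣ (tabulate-∘ (b xor_) (lookup V ∘ g)) ⟩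
      ∣ map (b xor_) (tabulate (lookup V ∘ g)) ∣ ∎)
  where open ≡-Reasoning

infixr 6 _⊕_

_⊕_ : Subset m → Subset n → Subset (m * n)
_⊕_ {n = n} U V = tabulate (uncurry (λ i j → lookup U i xor lookup V j) ∘ remQuot n)

lookup-⊕ : (U : Subset m) (V : Subset n) (i : Fin m) (j : Fin n) →
           lookup (U ⊕ V) (combine i j) ≡ lookup U i xor lookup V j
lookup-⊕ U V i j = trans (lookup∘tabulate _ (combine i j))
  (cong (uncurry (λ i j → lookup U i xor lookup V j)) (remQuot-combine i j))

∉⇒lookup≡false : {x : Fin n} {p : Subset n} → x ∉ p → lookup p x ≡ false
∉⇒lookup≡false {x = x} {p} x∉p = ¬-not (x∉p ∘ lookup⇒[]= x p)

⊕-⊂⊤ : {U : Subset m} {V : Subset n} → U ⊂ ⊤ → V ⊂ ⊤ → U ⊕ V ⊂ ⊤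
⊕-⊂⊤ {U = U} {V} (_ , i , _ , i∉U) (_ , j , _ , j∉V) =
  ⊆⊤ , combine i j , ∈⊤ , λ ij∈ → contradiction
    (trans (sym ([]=⇒lookup ij∈)) (trans (lookup-⊕ U V i j)
      (cong₂ _xor_ (∉⇒lookup≡false i∉U) (∉⇒lookup≡false j∉V))))
    λ ()

proposition3p1 : (k : ℕ) → 2 ≤ k → 2 ∣ k → (G H : Hypergraph k) →
    OddBipartite G → OddBipartite H → OddBipartite (G □ H)
proposition3p1 (suc k) _ 2∣k G H (_ , U , U⊂⊤ , oddU) (_ , V , V⊂⊤ , oddV) =
  2∣k , U ⊕ V , ⊕-⊂⊤ U⊂⊤ V⊂⊤ , odd
  where
  odd : ∀ e → E (G □ H) e → 2 ∤ ∣ e ∩ (U ⊕ V) ∣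
  odd _ ed@(i , j , refl , inj₁ (i-const , ∈H)) =
    -- As `i` is constant, its value at position `zero`, available since the uniformity is a
    -- successor, supplies the bit for all positions.
    odd-transfer _ j (U ⊕ V) V (lookup U (i zero))
      (λ a → trans (lookup-⊕ U V (i a) (j a))
        (cong (λ x → lookup U x xor lookup V (j a)) (i-const a zero)))
      (□-uniform G H _ ed) (uniform H _ ∈H) 2∣k (oddV _ ∈H)
  odd _ ed@(i , j , refl , inj₂ (j-const , ∈G)) =
    odd-transfer _ i (U ⊕ V) U (lookup V (j zero))
      (λ a → trans (lookup-⊕ U V (i a) (j a))
        -- Here the fixed coordinate is the second one, so its bit must first be brought to the
        -- left.
        (trans (xor-comm (lookup U (i a)) _)
          (cong (λ x → lookup V x xor lookup U (i a)) (j-const a zero))))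
      (□-uniform G H _ ed) (uniform G _ ∈G) 2∣k (oddU _ ∈G)
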